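{- Let $n\ge 1$ and $j$ be integers with $0\le j\le n-1$. Then \[ \sum_{k=j}^{n}(-1)^{k-j}{n\brace k}{k\brack j}H_k=\left(\binom{n}{j}-1\right)\frac{B_{n-j}}{n-j}. \]
   Context: $B_m$ denotes the $m$th Bernoulli number, defined by $\frac{t}{e^t-1}=\sum_{m\ge0}B_m\frac{t^m}{m!}$ (so $B_0=1$, $B_1=-1/2$). ${k\brack j}$ denotes the (unsigned) Stirling number of the first kind, defined by $x(x+1)\cdots(x+k-1)=\sum_{j=0}^k{k\brack j}x^j$, and ${n\brace k}$ the Stirling number of the second kind, defined by $x^n=\sum_{k=0}^n(-1)^{n-k}{n\brace k}x(x+1)\cdots(x+k-1)$. $H_k=1+\frac12+\cdots+\frac1k$ is the $k$th harmonic number, $H_0=0$. -}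

module Defs where

open import Algebra.Bundles using (CommutativeRing)
import Algebra.Properties.Semiring.Exp as Exp
import Algebra.Properties.Semiring.Sum as Sum
open import Data.Fin.Base using (toℕ)
import Data.Integer.Base as ℤ
open import Data.Nat.Base as ℕ using (ℕ; zero; suc; _∸_; _!; NonZero)
import Data.Nat.Properties as ℕ
open import Data.Product.Base using (∃; _,_)
open import Data.Rational.Base using (ℚ; 0ℚ; 1ℚ; _+_; _*_; _-_; -_; _/_; 1/_)
import Data.Rational.Base as ℚ
open import Data.Rational.Properties
open import Data.Rational.Solver using (module +-*-Solver)
open import Function.Base using (_∘_)
open import Relation.Binary.PropositionalEquality using (_≡_; refl; sym; trans; cong; cong₂; module ≡-Reasoning)

open Sum (CommutativeRing.semiring +-*-commutativeRing) public using (sum)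
open Exp (CommutativeRing.semiring +-*-commutativeRing) public using (_^_)

fromℕ : ℕ → ℚ
fromℕ n = ℤ.+ n / 1

1/ℕ : (d : ℕ) → .{{NonZero d}} → ℚ
1/ℕ d = ℤ.+ 1 / d

infix 9 1/!_
1/!_ : ℕ → ℚ
1/! m = 1/ℕ (m !) {{m ℕ.!≢0}}

-- Both endpoints are included; the sum is empty when b < a.
Σ[_⋯_] : ℕ → ℕ → (ℕ → ℚ) → ℚ
Σ[ a ⋯ b ] f = sum {suc b ∸ a} (λ i → f (a ℕ.+ toℕ i))

harmonic : ℕ → ℚ
harmonic k = Σ[ 1 ⋯ k ] term
  where
  term : ℕ → ℚ
  term zero    = 0ℚ   -- never used: the summation starts at 1
  term (suc i) = 1/ℕ (suc i)

-- Formal power series over ℚ, as coefficient sequences.  Polynomials are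
-- treated as elements of this larger ring: ℚ[X] ⊆ ℚ[[X]].

Series : Set
Series = ℕ → ℚ

infix 4 _≋_
_≋_ : Series → Series → Set
f ≋ g = ∀ m → f m ≡ g m

const : ℚ → Series
const a zero    = a
const a (suc _) = 0ℚ

X : Series
X 1 = 1ℚ
X _ = 0ℚ

infixl 6 _⊕_ _⊖_
infixl 7 _⊛_ _•_
infixr 8 X^_

_⊕_ _⊖_ _⊛_ : Series → Series → Series
(f ⊕ g) m = f m + g m
(f ⊖ g) m = f m - g m
(f ⊛ g) m = Σ[ 0 ⋯ m ] (λ i → f i * g (m ∸ i))

_•_ : ℚ → Series → Series
(a • f) m = a * f m

X^_ : ℕ → Series
X^ zero  = const 1ℚ
X^ suc n = X ⊛ X^ n

Σˢ[_⋯_] : ℕ → ℕ → (ℕ → Series) → Series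
Σˢ[ a ⋯ b ] F m = Σ[ a ⋯ b ] (λ i → F i m)

-- X (X + 1) ⋯ (X + k - 1)
rising : ℕ → Series
rising zero    = const 1ℚ
rising (suc k) = (X ⊕ const (fromℕ k)) ⊛ rising k

exp : Series
exp m = 1/! m

-- t / (eᵗ - 1) = Σ Bₘ tᵐ / m!, with the denominator cleared.  As ℚ[[t]] is a
-- domain and eᵗ - 1 ≠ 0, this determines B.
IsBernoulli : (ℕ → ℚ) → Set
IsBernoulli B = (exp ⊖ const 1ℚ) ⊛ (λ m → B m * 1/! m) ≋ X

-- The identity determines c k j for j ≤ k and says nothing about j > k.
IsStirling₁ : (ℕ → ℕ → ℚ) → Set
IsStirling₁ c = ∀ k → rising k ≋ Σˢ[ 0 ⋯ k ] (λ j → c k j • X^ j)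

-- The identity determines S n k for k ≤ n and says nothing about k > n.
IsStirling₂ : (ℕ → ℕ → ℚ) → Set
IsStirling₂ S = ∀ n → X^ n ≋ Σˢ[ 0 ⋯ n ] (λ k → ((- 1ℚ) ^ (n ∸ k) * S n k) • rising k)

private
  open ≡-Reasoning
  open +-*-Solver using (solve; _:+_; _:*_; _:-_; _:=_; con)

  drop-zero : ∀ x y → 0ℚ * x + y ≡ y
  drop-zero x y = trans (cong (_+ y) (*-zeroˡ x)) (+-identityˡ y)

  Σ< : ℕ → (ℕ → ℚ) → ℚ
  Σ< N f = sum {N} (λ i → f (toℕ i))

  Σ-cong : ∀ N (f g : ℕ → ℚ) → (∀ i → f i ≡ g i) → Σ< N f ≡ Σ< N g
  Σ-cong zero    f g h = refl
  Σ-cong (suc N) f g h = cong₂ _+_ (h 0) (Σ-cong N (f ∘ suc) (g ∘ suc) (h ∘ suc))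

  Σ-zero : ∀ N (f : ℕ → ℚ) → (∀ i → f i ≡ 0ℚ) → Σ< N f ≡ 0ℚ
  Σ-zero zero    f h = refl
  Σ-zero (suc N) f h = cong₂ _+_ (h 0) (Σ-zero N (f ∘ suc) (h ∘ suc))

  Σ-sub : ∀ N f g → Σ< N (λ i → f i - g i) ≡ Σ< N f - Σ< N g
  Σ-sub zero    f g = refl
  Σ-sub (suc N) f g = begin
    f 0 - g 0 + Σ< N (λ i → f (suc i) - g (suc i))
      ≡⟨ cong ((f 0 - g 0) +_) (Σ-sub N (f ∘ suc) (g ∘ suc)) ⟩
    f 0 - g 0 + (Σ< N (f ∘ suc) - Σ< N (g ∘ suc))
      ≡⟨ solve 4 (λ a b c d → a :- b :+ (c :- d) := a :+ c :- (b :+ d)) refl (f 0) (g 0) _ _ ⟩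
    f 0 + Σ< N (f ∘ suc) - (g 0 + Σ< N (g ∘ suc)) ∎

  Σ-shift : ∀ N h → h 0 + Σ< N (h ∘ suc) ≡ Σ< N h + h N
  Σ-shift zero    h = +-comm (h 0) 0ℚ
  Σ-shift (suc N) h = trans (cong (h 0 +_) (Σ-shift N (h ∘ suc))) (sym (+-assoc (h 0) _ _))

  shift : Series → Series
  shift s zero    = 0ℚ
  shift s (suc m) = s m

  linear-⊛ : ∀ a s m → ((X ⊕ const a) ⊛ s) m ≡ a * s m + shift s m
  linear-⊛ a s zero    = cong (λ z → z * s 0 + 0ℚ) (+-identityˡ a)
  linear-⊛ a s (suc m) = begin
    (0ℚ + a) * s (suc m) + ((1ℚ + 0ℚ) * s m + Σ< m (λ i → (0ℚ + 0ℚ) * s (m ∸ suc i)))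
      ≡⟨ cong (λ z → (0ℚ + a) * s (suc m) + ((1ℚ + 0ℚ) * s m + z))
           (Σ-zero m (λ i → (0ℚ + 0ℚ) * s (m ∸ suc i)) (λ i → *-zeroˡ (s (m ∸ suc i)))) ⟩
    (0ℚ + a) * s (suc m) + ((1ℚ + 0ℚ) * s m + 0ℚ)
      ≡⟨ cong₂ (λ y z → y * s (suc m) + z) (+-identityˡ a) (trans (+-identityʳ _) (*-identityˡ (s m))) ⟩
    a * s (suc m) + s m ∎

  X-⊛ : ∀ s m → (X ⊛ s) m ≡ shift s m
  X-⊛ s zero    = cong (_+ 0ℚ) (*-zeroˡ (s 0))
  X-⊛ s (suc m) = begin
    0ℚ * s (suc m) + (1ℚ * s m + Σ< m (λ i → 0ℚ * s (m ∸ suc i)))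
      ≡⟨ cong₂ (λ y z → y + (1ℚ * s m + z)) (*-zeroˡ (s (suc m)))
           (Σ-zero m (λ i → 0ℚ * s (m ∸ suc i)) (λ i → *-zeroˡ (s (m ∸ suc i)))) ⟩
    0ℚ + (1ℚ * s m + 0ℚ)
      ≡⟨ trans (+-identityˡ _) (trans (+-identityʳ _) (*-identityˡ (s m))) ⟩
    s m ∎

  rising-degree : ∀ k i → rising k (suc k ℕ.+ i) ≡ 0ℚ
  rising-degree zero    i = refl
  rising-degree (suc k) i = begin
    rising (suc k) (suc (suc k ℕ.+ i))
      ≡⟨ linear-⊛ (fromℕ k) (rising k) (suc (suc k ℕ.+ i)) ⟩
    fromℕ k * rising k (suc (suc k ℕ.+ i)) + rising k (suc k ℕ.+ i)
      ≡⟨ cong₂ (λ y z → fromℕ k * y + z)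
           (trans (cong (rising k ∘ suc) (sym (ℕ.+-suc k i))) (rising-degree k (suc i)))
           (rising-degree k i) ⟩
    fromℕ k * 0ℚ + 0ℚ
      ≡⟨ cong (_+ 0ℚ) (*-zeroʳ (fromℕ k)) ⟩
    0ℚ ∎

  monomials : ∀ N (f : ℕ → ℚ) → (∀ i → f (N ℕ.+ i) ≡ 0ℚ) → ∀ m → Σ< N (λ j → f j * (X^ j) m) ≡ f m
  monomials zero    f f≡0 m    = sym (f≡0 m)
  monomials (suc N) f f≡0 zero = begin
    f 0 * 1ℚ + Σ< N (λ j → f (suc j) * (X^ suc j) 0)
      ≡⟨ cong₂ _+_ (*-identityʳ (f 0)) (Σ-zero N (λ j → f (suc j) * (X^ suc j) 0) (λ j →
           trans (cong (f (suc j) *_) (X-⊛ (X^ j) 0)) (*-zeroʳ (f (suc j))))) ⟩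
    f 0 + 0ℚ
      ≡⟨ +-identityʳ (f 0) ⟩
    f 0 ∎
  monomials (suc N) f f≡0 (suc m) = begin
    f 0 * 0ℚ + Σ< N (λ j → f (suc j) * (X^ suc j) (suc m))
      ≡⟨ cong₂ _+_ (*-zeroʳ (f 0)) (Σ-cong N
           (λ j → f (suc j) * (X^ suc j) (suc m)) (λ j → f (suc j) * (X^ j) m)
           (λ j → cong (f (suc j) *_) (X-⊛ (X^ j) (suc m)))) ⟩
    0ℚ + Σ< N (λ j → f (suc j) * (X^ j) m)
      ≡⟨ +-identityˡ _ ⟩
    Σ< N (λ j → f (suc j) * (X^ j) m)
      ≡⟨ monomials N (f ∘ suc) f≡0 m ⟩
    f (suc m) ∎

  -- (-1)ⁿ⁻ᵏ times the Stirling number of the second kind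
  signed₂ : ℕ → ℕ → ℚ
  signed₂ zero    zero    = 1ℚ
  signed₂ zero    (suc k) = 0ℚ
  signed₂ (suc n) zero    = 0ℚ
  signed₂ (suc n) (suc k) = signed₂ n k - fromℕ (suc k) * signed₂ n (suc k)

  signed₂-degree : ∀ n i → signed₂ n (suc n ℕ.+ i) ≡ 0ℚ
  signed₂-degree zero    i = refl
  signed₂-degree (suc n) i = begin
    signed₂ n (suc n ℕ.+ i) - c * signed₂ n (suc (suc n ℕ.+ i))
      ≡⟨ cong₂ (λ y z → y - c * z) (signed₂-degree n i)
           (trans (cong (signed₂ n ∘ suc) (sym (ℕ.+-suc n i))) (signed₂-degree n (suc i))) ⟩
    0ℚ - c * 0ℚ
      ≡⟨ cong (λ z → 0ℚ - z) (*-zeroʳ c) ⟩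
    0ℚ ∎
    where c = fromℕ (suc (suc n ℕ.+ i))

  signed₂-step : ∀ n m → Σ< (suc (suc n)) (λ k → signed₂ (suc n) k * rising k m)
                       ≡ Σ< (suc n) (λ k → signed₂ n k * shift (rising k) m)
  signed₂-step n m = begin
    0ℚ * rising 0 m + Σ< N (λ k → (a k - fromℕ (suc k) * a (suc k)) * R (suc k))
      ≡⟨ drop-zero (rising 0 m) _ ⟩
    Σ< N (λ k → (a k - fromℕ (suc k) * a (suc k)) * R (suc k))
      ≡⟨ Σ-cong N (λ k → (a k - fromℕ (suc k) * a (suc k)) * R (suc k))
           (λ k → a k * R (suc k) - h (suc k))
           (λ k → solve 4 (λ x c y r → (x :- c :* y) :* r := x :* r :- c :* (y :* r))
                           refl (a k) (fromℕ (suc k)) (a (suc k)) (R (suc k))) ⟩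
    Σ< N (λ k → a k * R (suc k) - h (suc k))
      ≡⟨ Σ-sub N (λ k → a k * R (suc k)) (h ∘ suc) ⟩
    Σ< N (λ k → a k * R (suc k)) - Σ< N (h ∘ suc)
      ≡⟨ cong (λ z → Σ< N (λ k → a k * R (suc k)) - z) reindex ⟩
    Σ< N (λ k → a k * R (suc k)) - Σ< N h
      ≡⟨ sym (Σ-sub N (λ k → a k * R (suc k)) h) ⟩
    Σ< N (λ k → a k * R (suc k) - h k)
      ≡⟨ Σ-cong N (λ k → a k * R (suc k) - h k) (λ k → a k * shift (rising k) m)
           (λ k → trans (cong (λ z → a k * z - h k) (linear-⊛ (fromℕ k) (rising k) m))
           (solve 4 (λ x c r s → x :* (c :* r :+ s) :- c :* (x :* r) := x :* s)
              refl (a k) (fromℕ k) (R k) (shift (rising k) m))) ⟩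
    Σ< N (λ k → a k * shift (rising k) m) ∎
    where
    N = suc n
    a = signed₂ n
    R = λ k → rising k m
    h = λ k → fromℕ k * (a k * R k)
    hN≡0 : h N ≡ 0ℚ
    hN≡0 = begin
      fromℕ N * (a N * R N)
        ≡⟨ cong (λ z → fromℕ N * (z * R N))
             (trans (cong a (sym (ℕ.+-identityʳ N))) (signed₂-degree n 0)) ⟩
      fromℕ N * (0ℚ * R N)
        ≡⟨ cong (fromℕ N *_) (*-zeroˡ (R N)) ⟩
      fromℕ N * 0ℚ
        ≡⟨ *-zeroʳ (fromℕ N) ⟩
      0ℚ ∎
    reindex : Σ< N (h ∘ suc) ≡ Σ< N h
    reindex = begin
      Σ< N (h ∘ suc)        ≡⟨ sym (+-identityˡ _) ⟩
      0ℚ + Σ< N (h ∘ suc)   ≡⟨ cong (_+ Σ< N (h ∘ suc)) (sym (*-zeroˡ (a 0 * R 0))) ⟩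
      h 0 + Σ< N (h ∘ suc)  ≡⟨ Σ-shift N h ⟩
      Σ< N h + h N          ≡⟨ cong (Σ< N h +_) hN≡0 ⟩
      Σ< N h + 0ℚ           ≡⟨ +-identityʳ _ ⟩
      Σ< N h ∎

  signed₂-expand : ∀ n m → (X^ n) m ≡ Σ< (suc n) (λ k → signed₂ n k * rising k m)
  signed₂-expand zero    m = sym (trans (+-identityʳ _) (*-identityˡ _))
  signed₂-expand (suc n) m =
    trans (X-⊛ (X^ n) m) (trans (go m) (sym (signed₂-step n m)))
    where
    go : ∀ m → shift (X^ n) m ≡ Σ< (suc n) (λ k → signed₂ n k * shift (rising k) m)
    go zero    = sym (Σ-zero (suc n) (λ k → signed₂ n k * 0ℚ) (λ k → *-zeroʳ (signed₂ n k)))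
    go (suc m) = signed₂-expand n m

  sign² : ∀ p x → (- 1ℚ) ^ p * ((- 1ℚ) ^ p * x) ≡ x
  sign² zero    x = trans (*-identityˡ _) (*-identityˡ x)
  sign² (suc p) x = trans
    (solve 2 (λ s x → con (- 1ℚ) :* s :* (con (- 1ℚ) :* s :* x) := s :* (s :* x)) refl ((- 1ℚ) ^ p) x)
    (sign² p x)

  -- The reciprocal of (eᵗ - 1) / t: for N > m, recip N m is its m-th coefficient.
  recip : ℕ → Series
  recip zero    m       = 0ℚ
  recip (suc N) zero    = 1ℚ
  recip (suc N) (suc m) = - Σ< (suc m) (λ i → 1/! (suc (suc i)) * recip N (m ∸ i))

  recip-agree : ∀ N M m → m ℕ.< N → m ℕ.< M → recip N m ≡ recip M m
  recip-agree (suc N) (suc M) zero    _           _           = refl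
  recip-agree (suc N) (suc M) (suc m) (ℕ.s≤s m<N) (ℕ.s≤s m<M) = cong -_ (Σ-cong (suc m)
    (λ i → 1/! (suc (suc i)) * recip N (m ∸ i)) (λ i → 1/! (suc (suc i)) * recip M (m ∸ i)) (λ i →
    cong (1/! (suc (suc i)) *_) (recip-agree N M (m ∸ i)
      (ℕ.≤-<-trans (ℕ.m∸n≤m m i) m<N) (ℕ.≤-<-trans (ℕ.m∸n≤m m i) m<M))))

  recip∞ : Series
  recip∞ m = recip (suc m) m

  1/!-nonZero : ∀ m → ℚ.NonZero (1/! m)
  1/!-nonZero m = pos⇒nonZero (1/! m) {{normalize-pos 1 (m !) {{m ℕ.!≢0}}}}

  [exp-1]⊛recip : ∀ {g} → (∀ m → g m ≡ recip∞ m) → (exp ⊖ const 1ℚ) ⊛ g ≋ X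
  [exp-1]⊛recip {g} g≡ zero    = trans (+-identityʳ _) (*-zeroˡ (g 0))
  [exp-1]⊛recip {g} g≡ (suc m) = begin
    0ℚ * g (suc m) + Σ< (suc m) (λ i → (1/! (suc i) - 0ℚ) * g (m ∸ i))
      ≡⟨ drop-zero (g (suc m)) _ ⟩
    Σ< (suc m) (λ i → (1/! (suc i) - 0ℚ) * g (m ∸ i))
      ≡⟨ Σ-cong (suc m) (λ i → (1/! (suc i) - 0ℚ) * g (m ∸ i)) (λ i → 1/! (suc i) * recip∞ (m ∸ i))
           (λ i → cong₂ _*_ (+-identityʳ (1/! (suc i))) (g≡ (m ∸ i))) ⟩
    Σ< (suc m) (λ i → 1/! (suc i) * recip∞ (m ∸ i))
      ≡⟨ go m ⟩
    X (suc m) ∎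
    where
    go : ∀ m → Σ< (suc m) (λ i → 1/! (suc i) * recip∞ (m ∸ i)) ≡ X (suc m)
    go zero    = refl
    go (suc m) = begin
      1ℚ * recip∞ (suc m) + Σ< (suc m) (λ i → 1/! (suc (suc i)) * recip∞ (m ∸ i))
        ≡⟨ cong₂ _+_ (*-identityˡ (recip∞ (suc m))) (Σ-cong (suc m)
             (λ i → 1/! (suc (suc i)) * recip∞ (m ∸ i)) (λ i → 1/! (suc (suc i)) * recip (suc m) (m ∸ i))
             (λ i → cong (1/! (suc (suc i)) *_)
               (recip-agree (suc (m ∸ i)) (suc m) (m ∸ i) ℕ.≤-refl (ℕ.s≤s (ℕ.m∸n≤m m i))))) ⟩
      - T + T
        ≡⟨ +-inverseˡ T ⟩
      0ℚ ∎
      where T = Σ< (suc m) (λ i → 1/! (suc (suc i)) * recip (suc m) (m ∸ i))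

bernoulli-exists : ∃ IsBernoulli
bernoulli-exists = (λ m → recip∞ m * (1/ (1/! m)) {{1/!-nonZero m}}) , [exp-1]⊛recip (λ m →
  trans (*-assoc (recip∞ m) _ _)
    (trans (cong (recip∞ m *_) (*-inverseˡ (1/! m) {{1/!-nonZero m}})) (*-identityʳ (recip∞ m))))

stirling₁-exists : ∃ IsStirling₁
stirling₁-exists = rising , λ k m → sym (monomials (suc k) (rising k) (rising-degree k) m)

stirling₂-exists : ∃ IsStirling₂
stirling₂-exists = (λ n k → (- 1ℚ) ^ (n ∸ k) * signed₂ n k) , λ n m →
  trans (signed₂-expand n m)
    (Σ-cong (suc n) (λ k → signed₂ n k * rising k m)
      (λ k → (- 1ℚ) ^ (n ∸ k) * ((- 1ℚ) ^ (n ∸ k) * signed₂ n k) * rising k m)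
      (λ k → cong (_* rising k m) (sym (sign² (n ∸ k) (signed₂ n k)))))

{-# OPTIONS --safe #-}

-- Let L be the linear operator on polynomials with L (x)ₖ = Hₖ (x)ₖ on falling
-- factorials.  Since xⁿ = Σ S(n,k) (x)ₖ and (x)ₖ = Σ (-1)ᵏ⁻ʲ c(k,j) xʲ, the left
-- hand side is the coefficient of xʲ in L xⁿ.  From x (x)ₖ = (x)ₖ₊₁ + k (x)ₖ one
-- gets L (x p) = x L p + M p, where M (x)ₖ = (x)ₖ₊₁ / (k + 1).  So M is the inverse
-- of the forward difference with M p (0) = 0, that is, Faulhaber's formula
-- M xⁿ = Σⱼ n! / (j + 1)! · Bₙ₋ⱼ / (n - j)! · xʲ⁺¹, and the coefficients of L xⁿ
-- follow by recursion on n.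
--
-- In the proof the polynomials L xⁿ are defined by this recursion, and
-- L (x)ₖ = Hₖ (x)ₖ is derived; hence neither the uniqueness of the S(n,k) nor
-- their recurrence is needed.

module Submission where

open import Defs
open import Algebra.Bundles using (CommutativeRing)
import Algebra.Properties.CommutativeMonoid.Sum as CommutativeMonoidSum
import Algebra.Properties.Semiring.Exp as SemiringExp
import Algebra.Properties.Semiring.Sum as SemiringSum
open import Data.Fin.Base using (toℕ)
open import Data.Fin.Properties using (toℕ<n)
import Data.Integer.Base as ℤ
import Data.Integer.Properties as ℤ
open import Data.Nat.Base as ℕ using (ℕ; zero; suc; _∸_; _≤_; _<_; _!; NonZero; z≤n; s≤s; >-nonZero)
open import Data.Nat.Combinatorics using (_C_; nCk≡n!/k![n-k]!; k![n∸k]!∣n!; k>n⇒nCk≡0; nCk+nC[k+1]≡[n+1]C[k+1])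
open import Data.Nat.DivMod using (m/n*n≡m)
open import Data.Nat.Properties as ℕ using (m<n⇒0<n∸m; _!≢0; _!*_!≢0)
open import Data.Product.Base using (_,_)
open import Data.Rational.Base using (ℚ; 0ℚ; 1ℚ; _+_; _*_; _-_; -_; toℚᵘ)
open import Data.Rational.Properties
open import Data.Rational.Solver using (module +-*-Solver)
open import Data.Rational.Unnormalised.Base as ℚᵘ using (mkℚᵘ; *≡*)
import Data.Rational.Unnormalised.Properties as ℚᵘ
open import Function.Base using (_∘_)
open import Relation.Binary.PropositionalEquality using (_≡_; _≢_; refl; sym; trans; cong; cong₂; module ≡-Reasoning)
open import Relation.Nullary using (yes; no; contradiction)

open SemiringExp (CommutativeRing.semiring +-*-commutativeRing) using (^-homo-*)
open SemiringSum (CommutativeRing.semiring +-*-commutativeRing) using (sum-cong-≗; *-distribˡ-sum; *-distribʳ-sum)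
open CommutativeMonoidSum +-0-commutativeMonoid using (∑-distrib-+; ∑-comm)
open +-*-Solver using (solve; _:+_; _:*_; _:-_; :-_; _:=_; con)
open ≡-Reasoning

-- Natural numbers and their reciprocals in ℚ

-- Passing to unnormalised fractions turns identities about `fromℕ` into integer identities, free of
-- gcd normalisation.
toℚᵘ-fromℕ : ∀ n → toℚᵘ (fromℕ n) ℚᵘ.≃ mkℚᵘ (ℤ.+ n) 0
toℚᵘ-fromℕ n = toℚᵘ-fromℚᵘ (mkℚᵘ (ℤ.+ n) 0)

fromℕ-homo-+ : ∀ m n → fromℕ (m ℕ.+ n) ≡ fromℕ m + fromℕ n
fromℕ-homo-+ m n = toℚᵘ-injective (ℚᵘ.≃-trans (toℚᵘ-fromℕ (m ℕ.+ n)) (ℚᵘ.≃-sym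
  (ℚᵘ.≃-trans (toℚᵘ-homo-+ (fromℕ m) (fromℕ n))
  (ℚᵘ.≃-trans (ℚᵘ.+-cong (toℚᵘ-fromℕ m) (toℚᵘ-fromℕ n))
  (*≡* (cong (ℤ._* ℤ.+ 1) (cong₂ ℤ._+_ (ℤ.*-identityʳ (ℤ.+ m)) (ℤ.*-identityʳ (ℤ.+ n)))))))))

fromℕ-homo-* : ∀ m n → fromℕ (m ℕ.* n) ≡ fromℕ m * fromℕ n
fromℕ-homo-* m n = toℚᵘ-injective (ℚᵘ.≃-trans (toℚᵘ-fromℕ (m ℕ.* n)) (ℚᵘ.≃-sym
  (ℚᵘ.≃-trans (toℚᵘ-homo-* (fromℕ m) (fromℕ n))
  (ℚᵘ.≃-trans (ℚᵘ.*-cong (toℚᵘ-fromℕ m) (toℚᵘ-fromℕ n))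
  (*≡* (cong (ℤ._* ℤ.+ 1) (sym (ℤ.pos-* m n))))))))

fromℕ-suc : ∀ n → fromℕ (suc n) ≡ 1ℚ + fromℕ n
fromℕ-suc = fromℕ-homo-+ 1

1/ℕ-inverseʳ : ∀ d .{{_ : NonZero d}} → fromℕ d * 1/ℕ d ≡ 1ℚ
1/ℕ-inverseʳ (suc d) = toℚᵘ-injective
  (ℚᵘ.≃-trans (toℚᵘ-homo-* (fromℕ (suc d)) (1/ℕ (suc d)))
  (ℚᵘ.≃-trans (ℚᵘ.*-cong (toℚᵘ-fromℕ (suc d)) (toℚᵘ-fromℚᵘ (mkℚᵘ (ℤ.+ 1) d)))
  (*≡* (trans (ℤ.*-identityʳ (ℤ.+ suc d ℤ.* ℤ.+ 1)) (trans (ℤ.*-comm (ℤ.+ suc d) (ℤ.+ 1))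
    (sym (ℤ.*-identityˡ (ℤ.+ (1 ℕ.* suc d)))))))))

1/!-inverseʳ : ∀ n → fromℕ (n !) * 1/! n ≡ 1ℚ
1/!-inverseʳ n = 1/ℕ-inverseʳ (n !) {{n !≢0}}

*-cancelˡ-invertible : ∀ u a → u * a ≡ 1ℚ → ∀ x y → a * x ≡ a * y → x ≡ y
*-cancelˡ-invertible u a ua≡1 x y ax≡ay = begin
  x            ≡⟨ sym (*-identityˡ x) ⟩
  1ℚ * x       ≡⟨ cong (_* x) (sym ua≡1) ⟩
  u * a * x    ≡⟨ *-assoc u a x ⟩
  u * (a * x)  ≡⟨ cong (u *_) ax≡ay ⟩
  u * (a * y)  ≡⟨ sym (*-assoc u a y) ⟩
  u * a * y    ≡⟨ cong (_* y) ua≡1 ⟩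
  1ℚ * y       ≡⟨ *-identityˡ y ⟩
  y            ∎

-- Both sides are inverse to (n + 1)! in ℚ.
1/!-suc : ∀ n → 1/! (suc n) ≡ 1/ℕ (suc n) * 1/! n
1/!-suc n = *-cancelˡ-invertible (1/! (suc n)) (fromℕ (suc n !))
  (trans (*-comm (1/! (suc n)) (fromℕ (suc n !))) (1/!-inverseʳ (suc n))) _ _ (begin
  fromℕ (suc n !) * 1/! (suc n)
    ≡⟨ 1/!-inverseʳ (suc n) ⟩
  1ℚ
    ≡⟨ sym (*-identityˡ 1ℚ) ⟩
  1ℚ * 1ℚ
    ≡⟨ sym (cong₂ _*_ (1/ℕ-inverseʳ (suc n)) (1/!-inverseʳ n)) ⟩
  fromℕ (suc n) * 1/ℕ (suc n) * (fromℕ (n !) * 1/! n)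
    ≡⟨ solve 4 (λ a b c d → a :* b :* (c :* d) := a :* c :* (b :* d)) refl
         (fromℕ (suc n)) (1/ℕ (suc n)) (fromℕ (n !)) (1/! n) ⟩
  fromℕ (suc n) * fromℕ (n !) * (1/ℕ (suc n) * 1/! n)
    ≡⟨ cong (_* (1/ℕ (suc n) * 1/! n)) (sym (fromℕ-homo-* (suc n) (n !))) ⟩
  fromℕ (suc n !) * (1/ℕ (suc n) * 1/! n) ∎)

C-factorials : ∀ {n k} → k ≤ n → fromℕ (n C k) ≡ fromℕ (n !) * (1/! k * 1/! (n ∸ k))
C-factorials {n} {k} k≤n = begin
  fromℕ (n C k)
    ≡⟨ sym (trans (*-identityʳ _) (*-identityʳ _)) ⟩
  fromℕ (n C k) * 1ℚ * 1ℚ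
    ≡⟨ sym (cong₂ (λ y z → fromℕ (n C k) * y * z) (1/!-inverseʳ k) (1/!-inverseʳ (n ∸ k))) ⟩
  fromℕ (n C k) * (fromℕ (k !) * 1/! k) * (fromℕ ((n ∸ k) !) * 1/! (n ∸ k))
    ≡⟨ solve 5 (λ a b c d e → a :* (b :* c) :* (d :* e) := a :* (b :* d) :* (c :* e)) refl
         (fromℕ (n C k)) (fromℕ (k !)) (1/! k) (fromℕ ((n ∸ k) !)) (1/! (n ∸ k)) ⟩
  fromℕ (n C k) * (fromℕ (k !) * fromℕ ((n ∸ k) !)) * (1/! k * 1/! (n ∸ k))
    ≡⟨ cong (_* (1/! k * 1/! (n ∸ k))) (begin
         fromℕ (n C k) * (fromℕ (k !) * fromℕ ((n ∸ k) !))
           ≡⟨ cong (fromℕ (n C k) *_) (sym (fromℕ-homo-* (k !) ((n ∸ k) !))) ⟩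
         fromℕ (n C k) * fromℕ (k ! ℕ.* (n ∸ k) !)
           ≡⟨ sym (fromℕ-homo-* (n C k) (k ! ℕ.* (n ∸ k) !)) ⟩
         fromℕ ((n C k) ℕ.* (k ! ℕ.* (n ∸ k) !))
           ≡⟨ cong (λ z → fromℕ (z ℕ.* (k ! ℕ.* (n ∸ k) !))) (nCk≡n!/k![n-k]! k≤n) ⟩
         fromℕ (((n !) ℕ./ (k ! ℕ.* (n ∸ k) !)) {{k !* (n ∸ k) !≢0}} ℕ.* (k ! ℕ.* (n ∸ k) !))
           -- The quotient is a division in ℕ; it is exact because k! (n - k)! divides n!.
           ≡⟨ cong fromℕ (m/n*n≡m {{k !* (n ∸ k) !≢0}} (k![n∸k]!∣n! k≤n)) ⟩
         fromℕ (n !) ∎) ⟩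
  fromℕ (n !) * (1/! k * 1/! (n ∸ k)) ∎

-- Finite sums

-- `Σ[ a ⋯ b ] f` unfolds to `Σ< (suc b ∸ a) (λ i → f (a ℕ.+ i))`, so lemmas on `Σ<` apply to it
-- directly.
Σ< : ℕ → (ℕ → ℚ) → ℚ
Σ< N f = sum {N} (λ i → f (toℕ i))

Σ-cong-< : ∀ N {f g : ℕ → ℚ} → (∀ i → i < N → f i ≡ g i) → Σ< N f ≡ Σ< N g
Σ-cong-< N f≡g = sum-cong-≗ {N} (λ i → f≡g (toℕ i) (toℕ<n i))

Σ-cong : ∀ N {f g : ℕ → ℚ} → (∀ i → f i ≡ g i) → Σ< N f ≡ Σ< N g
Σ-cong N f≡g = Σ-cong-< N (λ i _ → f≡g i)

Σ-zero : ∀ N {f : ℕ → ℚ} → (∀ i → i < N → f i ≡ 0ℚ) → Σ< N f ≡ 0ℚ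
Σ-zero zero    f≡0 = refl
Σ-zero (suc N) f≡0 = cong₂ _+_ (f≡0 0 (s≤s z≤n)) (Σ-zero N (λ i i<N → f≡0 (suc i) (s≤s i<N)))

Σ-+ : ∀ N f g → Σ< N (λ i → f i + g i) ≡ Σ< N f + Σ< N g
Σ-+ N f g = ∑-distrib-+ {N} (f ∘ toℕ) (g ∘ toℕ)

Σ-*ˡ : ∀ N a f → a * Σ< N f ≡ Σ< N (λ i → a * f i)
Σ-*ˡ N a f = *-distribˡ-sum {N} a (f ∘ toℕ)

Σ-*ʳ : ∀ N a f → Σ< N f * a ≡ Σ< N (λ i → f i * a)
Σ-*ʳ N a f = *-distribʳ-sum {N} a (f ∘ toℕ)

Σ-last : ∀ N f → Σ< (suc N) f ≡ Σ< N f + f N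
Σ-last zero    f = +-comm (f 0) 0ℚ
Σ-last (suc N) f = trans (cong (f 0 +_) (Σ-last N (f ∘ suc))) (sym (+-assoc (f 0) _ _))

Σ-split : ∀ M N f → Σ< (M ℕ.+ N) f ≡ Σ< M f + Σ< N (λ i → f (M ℕ.+ i))
Σ-split zero    N f = sym (+-identityˡ _)
Σ-split (suc M) N f = trans (cong (f 0 +_) (Σ-split M N (f ∘ suc))) (sym (+-assoc (f 0) _ _))

Σ-reverse : ∀ N f → Σ< (suc N) (λ i → f (N ∸ i)) ≡ Σ< (suc N) f
Σ-reverse zero    f = refl
Σ-reverse (suc N) f = begin
  f (suc N) + Σ< (suc N) (λ i → f (N ∸ i))  ≡⟨ cong (f (suc N) +_) (Σ-reverse N f) ⟩
  f (suc N) + Σ< (suc N) f                  ≡⟨ +-comm (f (suc N)) _ ⟩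
  Σ< (suc N) f + f (suc N)                  ≡⟨ sym (Σ-last (suc N) f) ⟩
  Σ< (suc (suc N)) f                        ∎

⊛-comm : ∀ f g → f ⊛ g ≋ g ⊛ f
⊛-comm f g m = begin
  Σ< (suc m) (λ i → f i * g (m ∸ i))              ≡⟨ sym (Σ-reverse m (λ i → f i * g (m ∸ i))) ⟩
  Σ< (suc m) (λ i → f (m ∸ i) * g (m ∸ (m ∸ i)))  ≡⟨ Σ-cong-< (suc m) (λ i i<1+m →
    trans (cong (λ z → f (m ∸ i) * g z) (ℕ.m∸[m∸n]≡n (ℕ.s≤s⁻¹ i<1+m))) (*-comm (f (m ∸ i)) (g i))) ⟩
  Σ< (suc m) (λ i → g i * f (m ∸ i))              ∎

harmonic-suc : ∀ k → harmonic (suc k) ≡ harmonic k + 1/ℕ (suc k)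
harmonic-suc k = Σ-last k (λ i → 1/ℕ (suc i))

-- Coefficients of monomials and of rising factorials

-- Structural recursion makes `δ (suc m) ∘ suc` reduce to `δ m`; hence the coefficients of (x)ₖ₊₁ =
-- (x - k) (x)ₖ in positive degree follow by computation.
δ : ℕ → ℕ → ℚ
δ zero    zero    = 1ℚ
δ zero    (suc n) = 0ℚ
δ (suc m) zero    = 0ℚ
δ (suc m) (suc n) = δ m n

shift : Series → Series
shift s zero    = 0ℚ
shift s (suc m) = s m

linear-⊛ : ∀ a s m → ((X ⊕ const a) ⊛ s) m ≡ a * s m + shift s m
linear-⊛ a s zero    = cong (λ z → z * s 0 + 0ℚ) (+-identityˡ a)
linear-⊛ a s (suc m) = cong₂ _+_ (cong (_* s (suc m)) (+-identityˡ a)) (begin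
  (1ℚ + 0ℚ) * s m + Σ< m (λ i → (0ℚ + 0ℚ) * s (m ∸ suc i))
    ≡⟨ cong₂ _+_ (*-identityˡ (s m)) (Σ-zero m (λ i _ → *-zeroˡ (s (m ∸ suc i)))) ⟩
  s m + 0ℚ
    ≡⟨ +-identityʳ (s m) ⟩
  s m ∎)

X-⊛ : ∀ s → X ⊛ s ≋ shift s
X-⊛ s m = begin
  (X ⊛ s) m               ≡⟨ Σ-cong (suc m) (λ i → cong (_* s (m ∸ i)) (X≋X⊕0 i)) ⟩
  ((X ⊕ const 0ℚ) ⊛ s) m  ≡⟨ linear-⊛ 0ℚ s m ⟩
  0ℚ * s m + shift s m    ≡⟨ cong (_+ shift s m) (*-zeroˡ (s m)) ⟩
  0ℚ + shift s m          ≡⟨ +-identityˡ _ ⟩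
  shift s m               ∎
  where
  X≋X⊕0 : X ≋ X ⊕ const 0ℚ
  X≋X⊕0 zero    = refl
  X≋X⊕0 (suc i) = sym (+-identityʳ (X (suc i)))

X^-coefficient : ∀ j m → (X^ j) m ≡ δ j m
X^-coefficient zero    zero    = refl
X^-coefficient zero    (suc m) = refl
X^-coefficient (suc j) zero    = X-⊛ (X^ j) zero
X^-coefficient (suc j) (suc m) = trans (X-⊛ (X^ j) (suc m)) (X^-coefficient j m)

δ-sym : ∀ m n → δ m n ≡ δ n m
δ-sym zero    zero    = refl
δ-sym zero    (suc n) = refl
δ-sym (suc m) zero    = refl
δ-sym (suc m) (suc n) = δ-sym m n

Σ-δ : ∀ N (f : ℕ → ℚ) m → m < N → Σ< N (λ i → f i * δ i m) ≡ f m
Σ-δ (suc N) f zero    _         = begin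
  f 0 * 1ℚ + Σ< N (λ i → f (suc i) * 0ℚ)
    ≡⟨ cong₂ _+_ (*-identityʳ (f 0)) (Σ-zero N (λ i _ → *-zeroʳ (f (suc i)))) ⟩
  f 0 + 0ℚ
    ≡⟨ +-identityʳ (f 0) ⟩
  f 0 ∎
Σ-δ (suc N) f (suc m) (s≤s m<N) = begin
  f 0 * 0ℚ + Σ< N (λ i → f (suc i) * δ i m)
    ≡⟨ cong₂ _+_ (*-zeroʳ (f 0)) (Σ-δ N (f ∘ suc) m m<N) ⟩
  0ℚ + f (suc m)
    ≡⟨ +-identityˡ _ ⟩
  f (suc m) ∎

stirling₁-unique : ∀ c → IsStirling₁ c → ∀ {k j} → j ≤ k → c k j ≡ rising k j
stirling₁-unique c isS₁ {k} {j} j≤k = begin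
  c k j                                    ≡⟨ sym (Σ-δ (suc k) (c k) j (s≤s j≤k)) ⟩
  Σ< (suc k) (λ i → c k i * δ i j)         ≡⟨ Σ-cong (suc k) (λ i → cong (c k i *_) (sym (X^-coefficient i j))) ⟩
  Σ< (suc k) (λ i → c k i * (X^ i) j)      ≡⟨ sym (isS₁ k j) ⟩
  rising k j                               ∎

-- Linear functionals on falling factorials

-- The value at (x)ₖ of the linear functional xⁿ ↦ g n.
pair : ℕ → (ℕ → ℚ) → ℚ
pair zero    g = g 0
pair (suc k) g = pair k (g ∘ suc) - fromℕ k * pair k g

pair-cong : ∀ k {g h : ℕ → ℚ} → (∀ n → g n ≡ h n) → pair k g ≡ pair k h
pair-cong zero    g≡h = g≡h 0
pair-cong (suc k) g≡h = cong₂ (λ y z → y - fromℕ k * z) (pair-cong k (g≡h ∘ suc)) (pair-cong k g≡h)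

pair-+ : ∀ k g h → pair k (λ n → g n + h n) ≡ pair k g + pair k h
pair-+ zero    g h = refl
pair-+ (suc k) g h = trans
  (cong₂ (λ y z → y - fromℕ k * z) (pair-+ k (g ∘ suc) (h ∘ suc)) (pair-+ k g h))
  (solve 5 (λ a b c d e → a :+ b :- e :* (c :+ d) := a :- e :* c :+ (b :- e :* d)) refl
     (pair k (g ∘ suc)) (pair k (h ∘ suc)) (pair k g) (pair k h) (fromℕ k))

pair-zero : ∀ k → pair k (λ _ → 0ℚ) ≡ 0ℚ
pair-zero zero    = refl
pair-zero (suc k) = trans (cong (λ z → z - fromℕ k * z) (pair-zero k))
  (cong (λ z → 0ℚ - z) (*-zeroʳ (fromℕ k)))

-- The coefficient of xᵐ in (x)ₖ.
falling : ℕ → ℕ → ℚ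
falling k m = pair k (δ m)

falling-suc-0 : ∀ k → falling (suc k) 0 ≡ - (fromℕ k * falling k 0)
falling-suc-0 k = trans (cong (_- fromℕ k * falling k 0) (pair-zero k)) (+-identityˡ _)

-- (x)ₖ₊₁ has the factor x.
falling-constant : ∀ k → falling (suc k) 0 ≡ 0ℚ
falling-constant zero    = refl
falling-constant (suc k) = trans (falling-suc-0 (suc k)) (cong -_
  (trans (cong (fromℕ (suc k) *_) (falling-constant k)) (*-zeroʳ (fromℕ (suc k)))))

falling-degree : ∀ {k m} → k < m → falling k m ≡ 0ℚ
falling-degree {zero}  {suc m} _         = refl
falling-degree {suc k} {suc m} (s≤s k<m) = trans
  (cong₂ (λ y z → y - fromℕ k * z) (falling-degree k<m) (falling-degree (ℕ.m<n⇒m<1+n k<m)))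
  (cong (λ z → 0ℚ - z) (*-zeroʳ (fromℕ k)))

-- By linearity the functional is determined by the coefficients of (x)ₖ, and every N above the
-- degree bounds the sum. The induction uses (x)ₖ₊₁ = x (x)ₖ - k (x)ₖ, where the factor x turns g
-- into `g ∘ suc`.
pair-expand : ∀ k N g → k < N → Σ< N (λ i → falling k i * g i) ≡ pair k g
pair-expand zero (suc N) g _ = begin
  1ℚ * g 0 + Σ< N (λ i → 0ℚ * g (suc i))
    ≡⟨ cong₂ _+_ (*-identityˡ (g 0)) (Σ-zero N (λ i _ → *-zeroˡ (g (suc i)))) ⟩
  g 0 + 0ℚ
    ≡⟨ +-identityʳ (g 0) ⟩
  g 0 ∎
pair-expand (suc k) (suc N) g (s≤s k<N) = begin
  falling (suc k) 0 * g 0 + Σ< N (λ i → (f i - κ * f (suc i)) * g (suc i))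
    ≡⟨ cong₂ (λ y z → y * g 0 + z) (falling-suc-0 k) (trans
         (Σ-cong N (λ i → solve 4 (λ a c b y → (a :- c :* b) :* y := a :* y :+ :- c :* (b :* y)) refl
           (f i) κ (f (suc i)) (g (suc i))))
         (trans (Σ-+ N (λ i → f i * g (suc i)) (λ i → - κ * (f (suc i) * g (suc i))))
           (cong (P +_) (sym (Σ-*ˡ N (- κ) (λ i → f (suc i) * g (suc i))))))) ⟩
  - (κ * f 0) * g 0 + (P + - κ * Q)
    ≡⟨ solve 5 (λ c a x p q → :- (c :* a) :* x :+ (p :+ :- c :* q) := p :- c :* (a :* x :+ q)) refl
         κ (f 0) (g 0) P Q ⟩
  P - κ * Σ< (suc N) (λ i → f i * g i)
    ≡⟨ cong₂ (λ y z → y - κ * z) (pair-expand k N (g ∘ suc) k<N)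
         (pair-expand k (suc N) g (ℕ.m<n⇒m<1+n k<N)) ⟩
  pair k (g ∘ suc) - κ * pair k g ∎
  where
  κ = fromℕ k
  f = falling k
  P = Σ< N (λ i → f i * g (suc i))
  Q = Σ< N (λ i → f (suc i) * g (suc i))

-- Signs, and Stirling numbers in terms of falling factorials

sgn : ℕ → ℚ
sgn m = (- 1ℚ) ^ m

sgn² : ∀ m → sgn m * sgn m ≡ 1ℚ
sgn² zero    = refl
sgn² (suc m) = trans
  (solve 1 (λ s → con (- 1ℚ) :* s :* (con (- 1ℚ) :* s) := s :* s) refl (sgn m)) (sgn² m)

sgn-∸ : ∀ {m n} → m ≤ n → sgn (n ∸ m) ≡ sgn n * sgn m
sgn-∸ {m} {n} m≤n = begin
  sgn (n ∸ m)                    ≡⟨ sym (*-identityʳ _) ⟩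
  sgn (n ∸ m) * 1ℚ               ≡⟨ cong (sgn (n ∸ m) *_) (sym (sgn² m)) ⟩
  sgn (n ∸ m) * (sgn m * sgn m)  ≡⟨ sym (*-assoc (sgn (n ∸ m)) (sgn m) (sgn m)) ⟩
  sgn (n ∸ m) * sgn m * sgn m    ≡⟨ cong (_* sgn m) (sym (^-homo-* (- 1ℚ) (n ∸ m) m)) ⟩
  sgn (n ∸ m ℕ.+ m) * sgn m      ≡⟨ cong (λ z → sgn z * sgn m) (ℕ.m∸n+n≡m m≤n) ⟩
  sgn n * sgn m                  ∎

-- x (x + 1) ⋯ (x + k - 1) = (-1)ᵏ (-x)ₖ, and `sgn m` comes from xᵐ at -x.
rising-falling : ∀ k m → rising k m ≡ sgn k * sgn m * falling k m
rising-falling zero    zero    = refl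
rising-falling zero    (suc m) = sym (*-zeroʳ (1ℚ * sgn (suc m)))
rising-falling (suc k) zero    = begin
  rising (suc k) 0
    ≡⟨ linear-⊛ κ (rising k) 0 ⟩
  κ * rising k 0 + 0ℚ
    ≡⟨ cong (λ z → κ * z + 0ℚ) (rising-falling k 0) ⟩
  κ * (sgn k * 1ℚ * falling k 0) + 0ℚ
    ≡⟨ solve 3 (λ c s a → c :* (s :* con 1ℚ :* a) :+ con 0ℚ := con (- 1ℚ) :* s :* con 1ℚ :* :- (c :* a)) refl
         κ (sgn k) (falling k 0) ⟩
  sgn (suc k) * 1ℚ * - (κ * falling k 0)
    ≡⟨ cong (sgn (suc k) * 1ℚ *_) (sym (falling-suc-0 k)) ⟩
  sgn (suc k) * 1ℚ * falling (suc k) 0 ∎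
  where κ = fromℕ k
rising-falling (suc k) (suc m) = begin
  rising (suc k) (suc m)
    ≡⟨ linear-⊛ κ (rising k) (suc m) ⟩
  κ * rising k (suc m) + rising k m
    ≡⟨ cong₂ (λ y z → κ * y + z) (rising-falling k (suc m)) (rising-falling k m) ⟩
  κ * (sgn k * sgn (suc m) * falling k (suc m)) + sgn k * sgn m * falling k m
    ≡⟨ solve 5 (λ c s r a b → c :* (s :* (con (- 1ℚ) :* r) :* a) :+ s :* r :* b
                   := con (- 1ℚ) :* s :* (con (- 1ℚ) :* r) :* (b :- c :* a)) refl
         κ (sgn k) (sgn m) (falling k (suc m)) (falling k m) ⟩
  sgn (suc k) * sgn (suc m) * falling (suc k) (suc m) ∎
  where κ = fromℕ k

-- The sign (-1)ᵏ⁻ʲ in the theorem turns coefficients of rising factorials into those of falling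
-- factorials.
stirling₁-falling : ∀ c → IsStirling₁ c → ∀ {k j} → j ≤ k → sgn (k ∸ j) * c k j ≡ falling k j
stirling₁-falling c isS₁ {k} {j} j≤k = begin
  sgn (k ∸ j) * c k j
    ≡⟨ cong₂ _*_ (sgn-∸ j≤k) (trans (stirling₁-unique c isS₁ j≤k) (rising-falling k j)) ⟩
  sgn k * sgn j * (sgn k * sgn j * falling k j)
    ≡⟨ solve 3 (λ s r a → s :* r :* (s :* r :* a) := s :* s :* (r :* r) :* a) refl
         (sgn k) (sgn j) (falling k j) ⟩
  sgn k * sgn k * (sgn j * sgn j) * falling k j
    ≡⟨ cong₂ (λ y z → y * z * falling k j) (sgn² k) (sgn² j) ⟩
  1ℚ * 1ℚ * falling k j
    ≡⟨ *-identityˡ _ ⟩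
  falling k j ∎

-- Where `δ m n` is nonzero, m = n and the sign is a square.
sgn*δ : ∀ m n → sgn m * sgn n * δ m n ≡ δ m n
sgn*δ zero    zero    = refl
sgn*δ zero    (suc n) = *-zeroʳ (1ℚ * sgn (suc n))
sgn*δ (suc m) zero    = *-zeroʳ (sgn (suc m) * 1ℚ)
sgn*δ (suc m) (suc n) = trans
  (solve 3 (λ s r d → con (- 1ℚ) :* s :* (con (- 1ℚ) :* r) :* d := s :* r :* d) refl
     (sgn m) (sgn n) (δ m n))
  (sgn*δ m n)

-- Replacing x by -x in the defining identity and multiplying by (-1)ⁿ gives xⁿ = Σₖ S(n,k) (x)ₖ;
-- coefficients of xⁱ are compared.
stirling₂-falling : ∀ S → IsStirling₂ S → ∀ n i → Σ< (suc n) (λ k → S n k * falling k i) ≡ δ n i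
stirling₂-falling S isS₂ n i = sym (begin
  δ n i
    ≡⟨ sym (sgn*δ n i) ⟩
  sgn n * sgn i * δ n i
    ≡⟨ cong (sgn n * sgn i *_) (trans (sym (X^-coefficient n i)) (isS₂ n i)) ⟩
  sgn n * sgn i * Σ< (suc n) (λ k → sgn (n ∸ k) * S n k * rising k i)
    ≡⟨ Σ-*ˡ (suc n) (sgn n * sgn i) (λ k → sgn (n ∸ k) * S n k * rising k i) ⟩
  Σ< (suc n) (λ k → sgn n * sgn i * (sgn (n ∸ k) * S n k * rising k i))
    ≡⟨ Σ-cong-< (suc n) (λ k k<1+n → term k (ℕ.s≤s⁻¹ k<1+n)) ⟩
  Σ< (suc n) (λ k → S n k * falling k i) ∎)
  where
  term : ∀ k → k ≤ n → sgn n * sgn i * (sgn (n ∸ k) * S n k * rising k i) ≡ S n k * falling k i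
  term k k≤n = begin
    sgn n * sgn i * (sgn (n ∸ k) * S n k * rising k i)
      ≡⟨ cong₂ (λ y z → sgn n * sgn i * (y * S n k * z)) (sgn-∸ k≤n) (rising-falling k i) ⟩
    sgn n * sgn i * (sgn n * sgn k * S n k * (sgn k * sgn i * falling k i))
      ≡⟨ solve 5 (λ a b c s f → a :* b :* (a :* c :* s :* (c :* b :* f))
                     := a :* a :* (b :* b) :* (c :* c) :* (s :* f)) refl
           (sgn n) (sgn i) (sgn k) (S n k) (falling k i) ⟩
    sgn n * sgn n * (sgn i * sgn i) * (sgn k * sgn k) * (S n k * falling k i)
      ≡⟨ cong₂ (λ y z → y * z * (S n k * falling k i)) (cong₂ _*_ (sgn² n) (sgn² i)) (sgn² k) ⟩
    1ℚ * 1ℚ * 1ℚ * (S n k * falling k i)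
      ≡⟨ *-identityˡ _ ⟩
    S n k * falling k i ∎

-- Translation by 1 and the binomial theorem

-- The functional p ↦ g (p (x + 1)).
translate : (ℕ → ℚ) → ℕ → ℚ
translate g zero    = g 0
translate g (suc n) = translate g n + translate (g ∘ suc) n

-- (x + 1)ₖ₊₁ = (x + 1) (x)ₖ
pair-translate : ∀ k g → pair (suc k) (translate g) ≡ pair k (g ∘ suc) + pair k g
pair-translate zero g =
  solve 2 (λ a b → a :+ b :- con 0ℚ :* a := b :+ a) refl (g 0) (g 1)
pair-translate (suc k) g = begin
  pair (suc k) (translate g ∘ suc) - fromℕ (suc k) * pair (suc k) (translate g)
    ≡⟨ cong₂ (λ y z → y - z * pair (suc k) (translate g))
         (pair-+ (suc k) (translate g) (translate (g ∘ suc))) (fromℕ-suc k) ⟩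
  pair (suc k) (translate g) + pair (suc k) (translate (g ∘ suc)) - (1ℚ + κ) * pair (suc k) (translate g)
    ≡⟨ cong₂ (λ y z → y + z - (1ℚ + κ) * y) (pair-translate k g) (pair-translate k (g ∘ suc)) ⟩
  (p₁ + p₀) + (p₂ + p₁) - (1ℚ + κ) * (p₁ + p₀)
    ≡⟨ solve 4 (λ a b c e → (b :+ a) :+ (c :+ b) :- (con 1ℚ :+ e) :* (b :+ a)
                   := c :- e :* b :+ (b :- e :* a)) refl p₀ p₁ p₂ κ ⟩
  (p₂ - κ * p₁) + (p₁ - κ * p₀) ∎
  where
  κ  = fromℕ k
  p₀ = pair k g
  p₁ = pair k (g ∘ suc)
  p₂ = pair k (g ∘ suc ∘ suc)

-- Binomial theorem for (x + 1)ⁿ, by induction with Pascal's rule.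
translate-binomial : ∀ n g → translate g n ≡ Σ< (suc n) (λ i → fromℕ (n C i) * g i)
translate-binomial zero    g = sym (trans (+-identityʳ _) (*-identityˡ (g 0)))
translate-binomial (suc n) g = begin
  translate g n + translate (g ∘ suc) n
    ≡⟨ cong₂ _+_ (translate-binomial n g) (translate-binomial n (g ∘ suc)) ⟩
  Σ< (suc n) F + Σ< (suc n) G
    -- The vanishing term with n C (n + 1) is appended, so that after splitting off `F 0` both sums
    -- have the same range.
    ≡⟨ cong (_+ Σ< (suc n) G) (sym (begin
         Σ< (suc (suc n)) F
           ≡⟨ Σ-last (suc n) F ⟩
         Σ< (suc n) F + fromℕ (n C suc n) * g (suc n)
           ≡⟨ cong (λ z → Σ< (suc n) F + fromℕ z * g (suc n)) (k>n⇒nCk≡0 {n} {suc n} ℕ.≤-refl) ⟩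
         Σ< (suc n) F + 0ℚ * g (suc n)
           ≡⟨ trans (cong (Σ< (suc n) F +_) (*-zeroˡ (g (suc n)))) (+-identityʳ _) ⟩
         Σ< (suc n) F ∎)) ⟩
  F 0 + Σ< (suc n) (F ∘ suc) + Σ< (suc n) G
    ≡⟨ solve 3 (λ a b c → a :+ b :+ c := a :+ (c :+ b)) refl (F 0) (Σ< (suc n) (F ∘ suc)) (Σ< (suc n) G) ⟩
  F 0 + (Σ< (suc n) G + Σ< (suc n) (F ∘ suc))
    ≡⟨ cong (F 0 +_) (sym (Σ-+ (suc n) G (F ∘ suc))) ⟩
  fromℕ (suc n C 0) * g 0 + Σ< (suc n) (λ i → G i + F (suc i))
    ≡⟨ cong (fromℕ (suc n C 0) * g 0 +_) (Σ-cong (suc n) (λ i → begin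
         fromℕ (n C i) * g (suc i) + fromℕ (n C suc i) * g (suc i)
           ≡⟨ sym (*-distribʳ-+ (g (suc i)) (fromℕ (n C i)) (fromℕ (n C suc i))) ⟩
         (fromℕ (n C i) + fromℕ (n C suc i)) * g (suc i)
           ≡⟨ cong (_* g (suc i)) (trans (sym (fromℕ-homo-+ (n C i) (n C suc i)))
                (cong fromℕ (nCk+nC[k+1]≡[n+1]C[k+1] n i))) ⟩
         fromℕ (suc n C suc i) * g (suc i) ∎)) ⟩
  Σ< (suc (suc n)) (λ i → fromℕ (suc n C i) * g i) ∎
  where
  F = λ i → fromℕ (n C i) * g i
  G = λ i → fromℕ (n C i) * g (suc i)

-- Multiplication by powers of X

-- `shifts j s` is Xʲ s. At n it gives the coefficient of s at n - j, and 0 for n < j, where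
-- truncated subtraction would give the constant coefficient.
shifts : ℕ → Series → Series
shifts zero    s = s
shifts (suc j) s = shift (shifts j s)

shifts-⊛ : ∀ j s e → shifts j s ⊛ e ≋ shifts j (s ⊛ e)
shifts-⊛ zero    s e m       = refl
shifts-⊛ (suc j) s e zero    = trans (+-identityʳ _) (*-zeroˡ (e 0))
shifts-⊛ (suc j) s e (suc m) =
  trans (cong (_+ (shifts j s ⊛ e) m) (*-zeroˡ (e (suc m))))
    (trans (+-identityˡ _) (shifts-⊛ j s e m))

shifts-cong : ∀ j {s r} → s ≋ r → shifts j s ≋ shifts j r
shifts-cong zero    s≋r m       = s≋r m
shifts-cong (suc j) s≋r zero    = refl
shifts-cong (suc j) s≋r (suc m) = shifts-cong j s≋r m

shifts-⊕ : ∀ j s r → shifts j (s ⊕ r) ≋ shifts j s ⊕ shifts j r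
shifts-⊕ zero    s r m       = refl
shifts-⊕ (suc j) s r zero    = refl
shifts-⊕ (suc j) s r (suc m) = shifts-⊕ j s r m

shifts-X : ∀ j → shifts j X ≋ δ (suc j)
shifts-X zero    zero          = refl
shifts-X zero    (suc zero)    = refl
shifts-X zero    (suc (suc m)) = refl
shifts-X (suc j) zero          = refl
shifts-X (suc j) (suc m)       = shifts-X j m

shifts-+ : ∀ j s m → shifts j s (j ℕ.+ m) ≡ s m
shifts-+ zero    s m = refl
shifts-+ (suc j) s m = shifts-+ j s m

-- Where `δ m n` is nonzero, m = n and the factorials cancel.
!*1/!*δ : ∀ m n → fromℕ (n !) * 1/! m * δ m n ≡ δ m n
!*1/!*δ m n with m ℕ.≟ n
... | yes refl = trans (cong (_* δ m m) (1/!-inverseʳ m)) (*-identityˡ _)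
... | no  m≢n  = begin
  fromℕ (n !) * 1/! m * δ m n  ≡⟨ cong (fromℕ (n !) * 1/! m *_) (δ-≢ m≢n) ⟩
  fromℕ (n !) * 1/! m * 0ℚ     ≡⟨ *-zeroʳ (fromℕ (n !) * 1/! m) ⟩
  0ℚ                           ≡⟨ sym (δ-≢ m≢n) ⟩
  δ m n                        ∎
  where
  δ-≢ : ∀ {m n} → m ≢ n → δ m n ≡ 0ℚ
  δ-≢ {zero}  {zero}  m≢n = contradiction refl m≢n
  δ-≢ {zero}  {suc n} m≢n = refl
  δ-≢ {suc m} {zero}  m≢n = refl
  δ-≢ {suc m} {suc n} m≢n = δ-≢ (m≢n ∘ cong suc)

-- Faulhaber's formula from the Bernoulli generating function

module _ (B : ℕ → ℚ) (isB : IsBernoulli B) where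

  egf : Series
  egf m = B m * 1/! m

  -- Since (eᵗ - 1) · t/(eᵗ - 1) = t, multiplying t/(eᵗ - 1) by eᵗ adds t.
  egf⊛exp : egf ⊛ exp ≋ egf ⊕ X
  egf⊛exp m = begin
    (egf ⊛ exp) m
      ≡⟨ ⊛-comm egf exp m ⟩
    (exp ⊛ egf) m
      ≡⟨ solve 2 (λ a b → a := b :+ (a :- b)) refl ((exp ⊛ egf) m) (egf m) ⟩
    egf m + ((exp ⊛ egf) m - egf m)
      ≡⟨ cong (egf m +_) (trans (begin
           1ℚ * egf m + Q - egf m
             ≡⟨ solve 2 (λ a q → con 1ℚ :* a :+ q :- a := con 0ℚ :* a :+ q) refl (egf m) Q ⟩
           0ℚ * egf m + Q
             -- The constant coefficient of `exp ⊖ const 1ℚ` computes to 0; in the others 0 is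
             -- subtracted.
             ≡⟨ cong (0ℚ * egf m +_) (Σ-cong m (λ i →
                  cong (_* egf (m ∸ suc i)) (sym (+-identityʳ (exp (suc i)))))) ⟩
           ((exp ⊖ const 1ℚ) ⊛ egf) m ∎) (isB m)) ⟩
    egf m + X m ∎
    where Q = Σ< m (λ i → exp (suc i) * egf (m ∸ suc i))

  -- The coefficient of xʲ⁺¹ in the polynomial 0ⁿ + 1ⁿ + ⋯ + (x - 1)ⁿ, where 0⁰ = 1.
  faulhaber : ℕ → ℕ → ℚ
  faulhaber j n = fromℕ (n !) * 1/! (suc j) * shifts j egf n

  -- In a sum over 0 ≤ i < x, replacing iⁿ by (i + 1)ⁿ adds xⁿ - 0ⁿ, whose coefficient of xʲ⁺¹ is
  -- `δ (suc j) n`. In the proof the factorials turn the binomial sum into a product with `exp`, to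
  -- which `egf⊛exp` applies.
  translate-faulhaber : ∀ j n → translate (faulhaber j) n ≡ faulhaber j n + δ (suc j) n
  translate-faulhaber j n = begin
    translate (faulhaber j) n
      ≡⟨ translate-binomial n (faulhaber j) ⟩
    Σ< (suc n) (λ i → fromℕ (n C i) * faulhaber j i)
      ≡⟨ Σ-cong-< (suc n) (λ i i<1+n → term i (ℕ.s≤s⁻¹ i<1+n)) ⟩
    Σ< (suc n) (λ i → a * (shifts j egf i * exp (n ∸ i)))
      ≡⟨ sym (Σ-*ˡ (suc n) a (λ i → shifts j egf i * exp (n ∸ i))) ⟩
    a * (shifts j egf ⊛ exp) n
      ≡⟨ cong (a *_) (begin
           (shifts j egf ⊛ exp) n          ≡⟨ shifts-⊛ j egf exp n ⟩
           shifts j (egf ⊛ exp) n          ≡⟨ shifts-cong j egf⊛exp n ⟩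
           shifts j (egf ⊕ X) n            ≡⟨ shifts-⊕ j egf X n ⟩
           shifts j egf n + shifts j X n   ≡⟨ cong (shifts j egf n +_) (shifts-X j n) ⟩
           shifts j egf n + δ (suc j) n    ∎) ⟩
    a * (shifts j egf n + δ (suc j) n)
      ≡⟨ *-distribˡ-+ a (shifts j egf n) (δ (suc j) n) ⟩
    faulhaber j n + a * δ (suc j) n
      ≡⟨ cong (faulhaber j n +_) (!*1/!*δ (suc j) n) ⟩
    faulhaber j n + δ (suc j) n ∎
    where
    a = fromℕ (n !) * 1/! (suc j)
    term : ∀ i → i ≤ n → fromℕ (n C i) * faulhaber j i ≡ a * (shifts j egf i * exp (n ∸ i))
    term i i≤n = begin
      fromℕ (n C i) * faulhaber j i
        ≡⟨ cong (_* faulhaber j i) (C-factorials i≤n) ⟩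
      fromℕ (n !) * (1/! i * 1/! (n ∸ i)) * (fromℕ (i !) * 1/! (suc j) * shifts j egf i)
        ≡⟨ solve 6 (λ N r s I J b → N :* (r :* s) :* (I :* J :* b) := I :* r :* (N :* J :* (b :* s))) refl
             (fromℕ (n !)) (1/! i) (1/! (n ∸ i)) (fromℕ (i !)) (1/! (suc j)) (shifts j egf i) ⟩
      fromℕ (i !) * 1/! i * (a * (shifts j egf i * exp (n ∸ i)))
        ≡⟨ trans (cong (_* (a * (shifts j egf i * exp (n ∸ i)))) (1/!-inverseʳ i)) (*-identityˡ _) ⟩
      a * (shifts j egf i * exp (n ∸ i)) ∎

  -- The functional `faulhaber j` takes at (x + 1)ₖ₊₁ the value p₁ + p₀ by `pair-translate`, and p₁
  -- - k p₀ + f by `translate-faulhaber`. Hence (k + 1) p₀ = f, which is M (x)ₖ = (x)ₖ₊₁ / (k + 1)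
  -- on coefficients.
  pair-faulhaber : ∀ k j → pair k (faulhaber j) ≡ 1/ℕ (suc k) * falling (suc k) (suc j)
  pair-faulhaber k j = begin
    p₀
      -- A ring identity for arbitrary u and a. The second summand vanishes since a u = 1, the third
      -- because its bracket is the difference of the two evaluations.
      ≡⟨ solve 5 (λ u a p q f → p := u :* f :+ (con 1ℚ :- a :* u) :* p
                     :+ u :* ((q :+ p) :- (q :- (a :- con 1ℚ) :* p :+ f)))
           refl (1/ℕ (suc k)) (fromℕ (suc k)) p₀ p₁ f ⟩
    u * f + (1ℚ - fromℕ (suc k) * u) * p₀ + u * ((p₁ + p₀) - (p₁ - (fromℕ (suc k) - 1ℚ) * p₀ + f))
      ≡⟨ cong₂ (λ y z → u * f + (1ℚ - y) * p₀ + u * z) (1/ℕ-inverseʳ (suc k)) (begin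
           (p₁ + p₀) - (p₁ - (fromℕ (suc k) - 1ℚ) * p₀ + f)
             ≡⟨ cong (λ y → (p₁ + p₀) - (p₁ - y * p₀ + f)) (trans (cong (_- 1ℚ) (fromℕ-suc k))
                  (solve 1 (λ κ → con 1ℚ :+ κ :- con 1ℚ := κ) refl (fromℕ k))) ⟩
           (p₁ + p₀) - (pair (suc k) (faulhaber j) + f)
             ≡⟨ cong (λ y → y - (pair (suc k) (faulhaber j) + f)) (sym (pair-translate k (faulhaber j))) ⟩
           pair (suc k) (translate (faulhaber j)) - (pair (suc k) (faulhaber j) + f)
             ≡⟨ cong (_- (pair (suc k) (faulhaber j) + f)) (trans
                  (pair-cong (suc k) (translate-faulhaber j)) (pair-+ (suc k) (faulhaber j) (δ (suc j)))) ⟩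
           (pair (suc k) (faulhaber j) + f) - (pair (suc k) (faulhaber j) + f)
             ≡⟨ +-inverseʳ (pair (suc k) (faulhaber j) + f) ⟩
           0ℚ ∎) ⟩
    u * f + (1ℚ - 1ℚ) * p₀ + u * 0ℚ
      ≡⟨ solve 3 (λ u f p → u :* f :+ (con 1ℚ :- con 1ℚ) :* p :+ u :* con 0ℚ := u :* f) refl u f p₀ ⟩
    u * f ∎
    where
    u  = 1/ℕ (suc k)
    f  = falling (suc k) (suc j)
    p₀ = pair k (faulhaber j)
    p₁ = pair k (faulhaber j ∘ suc)

  -- The operator L on monomials and on falling factorials

  -- The coefficient of xʲ in L xⁿ.
  L : ℕ → ℕ → ℚ
  L j       zero    = 0ℚ
  L zero    (suc n) = 0ℚ
  L (suc j) (suc n) = L j n + faulhaber j n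

  L-zero : ∀ n → L 0 n ≡ 0ℚ
  L-zero zero    = refl
  L-zero (suc n) = refl

  -- By induction, L (x)ₖ₊₁ = x L (x)ₖ + M (x)ₖ - k L (x)ₖ = (Hₖ + 1/(k + 1)) (x)ₖ₊₁.
  pair-L : ∀ k j → pair k (L j) ≡ harmonic k * falling k j
  pair-L zero    j       = sym (*-zeroˡ (δ j 0))
  pair-L (suc k) zero    = begin
    pair (suc k) (L 0)                      ≡⟨ trans (pair-cong (suc k) L-zero) (pair-zero (suc k)) ⟩
    0ℚ                                      ≡⟨ sym (*-zeroʳ (harmonic (suc k))) ⟩
    harmonic (suc k) * 0ℚ                   ≡⟨ cong (harmonic (suc k) *_) (sym (falling-constant k)) ⟩
    harmonic (suc k) * falling (suc k) 0    ∎
  pair-L (suc k) (suc j) = begin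
    pair k (L (suc j) ∘ suc) - fromℕ k * pair k (L (suc j))
      ≡⟨ cong₂ (λ y z → y - fromℕ k * z)
           (trans (pair-+ k (L j) (faulhaber j)) (cong₂ _+_ (pair-L k j) (pair-faulhaber k j)))
           (pair-L k (suc j)) ⟩
    h * f₀ + u * (f₀ - fromℕ k * f₁) - fromℕ k * (h * f₁)
      ≡⟨ solve 5 (λ h u c a b → h :* a :+ u :* (a :- c :* b) :- c :* (h :* b) := (h :+ u) :* (a :- c :* b)) refl
           h u (fromℕ k) f₀ f₁ ⟩
    (h + u) * (f₀ - fromℕ k * f₁)
      ≡⟨ cong (_* falling (suc k) (suc j)) (sym (harmonic-suc k)) ⟩
    harmonic (suc k) * falling (suc k) (suc j) ∎
    where
    h  = harmonic k
    u  = 1/ℕ (suc k)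
    f₀ = falling k j
    f₁ = falling k (suc j)

  -- Induction on j with n - j = p + 1 fixed. Each step of the recursion adds C(n, j + 1) Bₚ₊₁ / (p
  -- + 1), and Pascal's rule turns C(n, j) + C(n, j + 1) into C(n + 1, j + 1). At j = 0 both sides
  -- vanish.
  L-closed : ∀ j p → L j (j ℕ.+ suc p) ≡ (fromℕ ((j ℕ.+ suc p) C j) - 1ℚ) * (B (suc p) * 1/ℕ (suc p))
  L-closed zero    p = sym (*-zeroˡ (B (suc p) * 1/ℕ (suc p)))
  L-closed (suc j) p = begin
    L j n + fromℕ (n !) * 1/! (suc j) * shifts j egf n
      ≡⟨ cong₂ (λ y z → y + fromℕ (n !) * 1/! (suc j) * z) (L-closed j p)
           (trans (shifts-+ j egf (suc p)) (cong (B (suc p) *_) (1/!-suc p))) ⟩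
    (fromℕ (n C j) - 1ℚ) * (B (suc p) * u) + fromℕ (n !) * 1/! (suc j) * (B (suc p) * (u * 1/! p))
      ≡⟨ solve 6 (λ x b u N J P → (x :- con 1ℚ) :* (b :* u) :+ N :* J :* (b :* (u :* P))
                     := (x :+ N :* (J :* P) :- con 1ℚ) :* (b :* u)) refl
           (fromℕ (n C j)) (B (suc p)) u (fromℕ (n !)) (1/! (suc j)) (1/! p) ⟩
    (fromℕ (n C j) + fromℕ (n !) * (1/! (suc j) * 1/! p) - 1ℚ) * (B (suc p) * u)
      ≡⟨ cong (λ z → (z - 1ℚ) * (B (suc p) * u)) (begin
           fromℕ (n C j) + fromℕ (n !) * (1/! (suc j) * 1/! p)
             ≡⟨ cong (λ z → fromℕ (n C j) + fromℕ (n !) * (1/! (suc j) * 1/! z)) (sym n∸1+j≡p) ⟩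
           fromℕ (n C j) + fromℕ (n !) * (1/! (suc j) * 1/! (n ∸ suc j))
             ≡⟨ cong (fromℕ (n C j) +_) (sym (C-factorials 1+j≤n)) ⟩
           fromℕ (n C j) + fromℕ (n C suc j)
             ≡⟨ sym (fromℕ-homo-+ (n C j) (n C suc j)) ⟩
           fromℕ ((n C j) ℕ.+ (n C suc j))
             ≡⟨ cong fromℕ (nCk+nC[k+1]≡[n+1]C[k+1] n j) ⟩
           fromℕ (suc n C suc j) ∎) ⟩
    (fromℕ (suc n C suc j) - 1ℚ) * (B (suc p) * u) ∎
    where
    n = j ℕ.+ suc p
    u = 1/ℕ (suc p)
    1+j≤n : suc j ≤ n
    1+j≤n = ℕ.m<m+n j (s≤s z≤n)
    n∸1+j≡p : n ∸ suc j ≡ p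
    n∸1+j≡p = trans (cong (_∸ suc j) (ℕ.+-suc j p)) (ℕ.m+n∸m≡n j p)

  -- The coefficient of xʲ in L applied to xⁿ = Σₖ S(n,k) (x)ₖ, with L (x)ₖ = Hₖ (x)ₖ.
  Σ-L : ∀ S → IsStirling₂ S → ∀ n j → Σ< (suc n) (λ k → S n k * (harmonic k * falling k j)) ≡ L j n
  Σ-L S isS₂ n j = begin
    Σ< N (λ k → S n k * (harmonic k * falling k j))
      -- Each (x)ₖ is expanded up to the common bound N rather than its own degree, so that the two
      -- sums can be exchanged.
      ≡⟨ Σ-cong-< N (λ k k<N → trans
           (cong (S n k *_) (sym (trans (pair-expand k N (L j) k<N) (pair-L k j))))
           (Σ-*ˡ N (S n k) (λ i → falling k i * L j i))) ⟩
    Σ< N (λ k → Σ< N (λ i → S n k * (falling k i * L j i)))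
      ≡⟨ ∑-comm {N} {N} (λ k i → S n (toℕ k) * (falling (toℕ k) (toℕ i) * L j (toℕ i))) ⟩
    Σ< N (λ i → Σ< N (λ k → S n k * (falling k i * L j i)))
      ≡⟨ Σ-cong N (λ i → begin
           Σ< N (λ k → S n k * (falling k i * L j i))
             ≡⟨ Σ-cong N (λ k → sym (*-assoc (S n k) (falling k i) (L j i))) ⟩
           Σ< N (λ k → S n k * falling k i * L j i)
             ≡⟨ sym (Σ-*ʳ N (L j i) (λ k → S n k * falling k i)) ⟩
           Σ< N (λ k → S n k * falling k i) * L j i
             ≡⟨ cong (_* L j i) (trans (stirling₂-falling S isS₂ n i) (δ-sym n i)) ⟩
           δ i n * L j i
             ≡⟨ *-comm (δ i n) (L j i) ⟩
           L j i * δ i n ∎) ⟩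
    Σ< N (λ i → L j i * δ i n)
      ≡⟨ Σ-δ N (L j) n ℕ.≤-refl ⟩
    L j n ∎
    where N = suc n

-- The range of summation and the final identity

-- Lets the sum of the theorem start at 0 instead of j: the coefficient of xʲ in (x)ₖ is 0 for k <
-- j.
Σ⋯-drop-zeros : ∀ a b (f : ℕ → ℚ) → a ≤ b → (∀ i → i < a → f i ≡ 0ℚ) → Σ[ a ⋯ b ] f ≡ Σ< (suc b) f
Σ⋯-drop-zeros a b f a≤b f≡0 = sym (begin
  Σ< (suc b) f
    ≡⟨ cong (λ N → Σ< N f) (sym (ℕ.m+[n∸m]≡n (ℕ.m≤n⇒m≤1+n a≤b))) ⟩
  Σ< (a ℕ.+ (suc b ∸ a)) f
    ≡⟨ Σ-split a (suc b ∸ a) f ⟩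
  Σ< a f + Σ[ a ⋯ b ] f
    ≡⟨ trans (cong (_+ Σ[ a ⋯ b ] f) (Σ-zero a f≡0)) (+-identityˡ _) ⟩
  Σ[ a ⋯ b ] f ∎)

mainTheorem1 : (B : ℕ → ℚ) → IsBernoulli B →
    (c : ℕ → ℕ → ℚ) → IsStirling₁ c →
    (S : ℕ → ℕ → ℚ) → IsStirling₂ S →
    (n j : ℕ) → 1 ≤ n → (j<n : j < n) →
    Σ[ j ⋯ n ] (λ k → (- 1ℚ) ^ (k ∸ j) * S n k * c k j * harmonic k)
    ≡ (fromℕ (n C j) - 1ℚ) * (B (n ∸ j) * 1/ℕ (n ∸ j) {{>-nonZero (m<n⇒0<n∸m j<n)}})
mainTheorem1 B isB c isS₁ S isS₂ n j _ j<n = begin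
  Σ[ j ⋯ n ] (λ k → (- 1ℚ) ^ (k ∸ j) * S n k * c k j * harmonic k)
    ≡⟨ Σ-cong (suc n ∸ j) (λ i → term (j ℕ.+ i) (ℕ.m≤m+n j i)) ⟩
  Σ[ j ⋯ n ] (λ k → S n k * (harmonic k * falling k j))
    ≡⟨ Σ⋯-drop-zeros j n (λ k → S n k * (harmonic k * falling k j)) (ℕ.<⇒≤ j<n) (λ k k<j → begin
         S n k * (harmonic k * falling k j)  ≡⟨ cong (λ z → S n k * (harmonic k * z)) (falling-degree k<j) ⟩
         S n k * (harmonic k * 0ℚ)           ≡⟨ cong (S n k *_) (*-zeroʳ (harmonic k)) ⟩
         S n k * 0ℚ                          ≡⟨ *-zeroʳ (S n k) ⟩
         0ℚ                                  ∎) ⟩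
  Σ< (suc n) (λ k → S n k * (harmonic k * falling k j))
    ≡⟨ Σ-L B isB S isS₂ n j ⟩
  L B isB j n
    ≡⟨ closed ⟩
  (fromℕ (n C j) - 1ℚ) * (B (n ∸ j) * 1/ℕ (n ∸ j) {{>-nonZero (m<n⇒0<n∸m j<n)}}) ∎
  where
  term : ∀ k → j ≤ k → (- 1ℚ) ^ (k ∸ j) * S n k * c k j * harmonic k ≡ S n k * (harmonic k * falling k j)
  term k j≤k = trans
    (solve 4 (λ s a c h → s :* a :* c :* h := a :* (h :* (s :* c))) refl
       (sgn (k ∸ j)) (S n k) (c k j) (harmonic k))
    (cong (λ z → S n k * (harmonic k * z)) (stirling₁-falling c isS₁ j≤k))

  -- A variable d with its own instance stands for `n ∸ j`, so that both equations can be matched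
  -- with `refl`.
  at : ∀ d p .{{_ : NonZero d}} → n ≡ j ℕ.+ suc p → d ≡ suc p →
       L B isB j n ≡ (fromℕ (n C j) - 1ℚ) * (B d * 1/ℕ d)
  at .(suc p) p refl refl = L-closed B isB j p

  closed : L B isB j n ≡ (fromℕ (n C j) - 1ℚ) * (B (n ∸ j) * 1/ℕ (n ∸ j) {{>-nonZero (m<n⇒0<n∸m j<n)}})
  closed with ℕ.m≤n⇒∃[o]m+o≡n j<n
  ... | p , 1+j+p≡n = at (n ∸ j) p {{>-nonZero (m<n⇒0<n∸m j<n)}} n≡j+1+p
          (trans (cong (_∸ j) n≡j+1+p) (ℕ.m+n∸m≡n j (suc p)))
    where
    n≡j+1+p : n ≡ j ℕ.+ suc p
    n≡j+1+p = trans (sym 1+j+p≡n) (sym (ℕ.+-suc j p))
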